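{- Let $k\geq 2$ and let $S\subseteq T(k)$ be a full and jump free family of functions. Fix arbitrary bijections $\gamma_0,\gamma_1,\gamma_2: N\to Z$. Then for each integer $p\geq 2$ there exist a function $f_p\in S$ and a set $E\subset N$ with $|E|=p$ and $E^k\subseteq \mathrm{domain}(f_p)$ such that $F(\hat f_p)=H(\hat f_p)$, where $\hat f_p = f_p|_{E^k}$ and $$F(\hat f_p)=\gamma_0(A_0)\cup\gamma_1(A_1)\cup\gamma_2(A_2),\qquad H(\hat f_p)=\gamma_0(A_0)\cup\gamma_2(A_2),$$ with $A_0=\{f_p(x)\mid x\in E^k,\ f_p(x)<\min(E)\}$, $A_1=\{f_p(x)\mid x\in E^k,\ \min(E)\le f_p(x)<\min(x)\}$, $A_2=\{f_p(x)\mid x\in E^k,\ f_p(x)\ge \min(x)\}$.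
   Context: $N$ denotes the nonnegative integers and $Z$ the integers. For $x=(n_1,\dots,n_k)\in N^k$, $\max(x)=\max_i n_i$ and $\min(x)=\min_i n_i$. For $E\subseteq N$, $E^k$ is the $k$-th Cartesian power. For a bijection $\gamma:N\to Z$ and $X\subseteq N$, $\gamma(X)=\{\gamma(x)\mid x\in X\}$ (with $\gamma(\emptyset)=\emptyset$). For $A\subseteq N^k$, $\mathrm{field}(A)$ is the set of all coordinates of elements of $A$. A function $f$ is reflexive if $\mathrm{domain}(f)\subseteq N^k$ and $\mathrm{range}(f)\subseteq \mathrm{field}(\mathrm{domain}(f))$. $T(k)$ is the set of all reflexive functions with finite domain contained in $N^k$; a function with domain $D$ is written $f_D$. A family $Q\subseteq T(k)$ is full if for every finite $D\subset N^k$ there is at least one $f\in Q$ with domain $D$. For finite $D\subset N^k$ and $x\in D$, let $D_x=\{z\in D\mid \max(z)<\max(x)\}$. A family $Q\subseteq T(k)$ is jump free if for all $f_A,f_B\in Q$ and all $x\in A\cap B$: if $A_x\subseteq B_x$ and $f_A(y)=f_B(y)$ for all $y\in A_x$, then $f_A(x)\ge f_B(x)$. -}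

module Defs where

open import Data.Nat using (ℕ; zero; suc; _≤_; _<_; _≥_; _⊓_; _⊔_)
open import Data.Integer using (ℤ)
open import Data.List using (List; []; _∷_; foldr)
import Data.List.Membership.Propositional as L
open import Data.Vec using (Vec; []; _∷_)
import Data.Vec.Membership.Propositional as V
open import Data.Vec.Relation.Unary.All using (All)
open import Data.Product using (Σ; _×_; _,_; ∃)
open import Data.Sum using (_⊎_)
open import Function.Bundles using (_⇔_; _⤖_; Bijection)
open import Relation.Binary.PropositionalEquality using (_≡_)

Pt : ℕ → Set
Pt k = Vec ℕ k

-- max / min of the coordinates of a point (0 for the empty vector; only
-- used with k ≥ 2 where vectors are nonempty).
vmax : ∀ {k} → Pt k → ℕ
vmax [] = 0
vmax (n ∷ ns) = n ⊔ vmax ns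

vmin : ∀ {k} → Pt k → ℕ
vmin [] = 0
vmin (n ∷ ns) = Data.Vec.foldr _ _⊓_ n ns

-- min of a finite set of naturals given as a list (0 for the empty list;
-- only used for nonempty E).
lmin : List ℕ → ℕ
lmin [] = 0
lmin (n ∷ ns) = foldr _⊓_ n ns

-- A finite subset of N^k is given by a list of points (membership = set).
-- field(D): all coordinates of elements of D.
InField : ∀ {k} → ℕ → List (Pt k) → Set
InField n D = ∃ λ y → y L.∈ D × n V.∈ y

-- Element of T(k): a function with finite domain dom ⊆ N^k (values outside
-- dom are irrelevant), reflexive: range ⊆ field(dom).
record T (k : ℕ) : Set where
  field
    dom  : List (Pt k)
    val  : Pt k → ℕ
    refl : ∀ x → x L.∈ dom → InField (val x) dom
open T public

Family : ℕ → Set₁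
Family k = T k → Set

HasDomain : ∀ {k} → T k → List (Pt k) → Set
HasDomain f D = ∀ x → (x L.∈ dom f) ⇔ (x L.∈ D)

Full : ∀ {k} → Family k → Set
Full {k} Q = (D : List (Pt k)) → Σ (T k) λ f → Q f × HasDomain f D

_∈_[_] : ∀ {k} → Pt k → T k → Pt k → Set
z ∈ f [ x ] = z L.∈ dom f × vmax z < vmax x

JumpFree : ∀ {k} → Family k → Set
JumpFree {k} Q = ∀ (fA fB : T k) → Q fA → Q fB → ∀ (x : Pt k) →
  x L.∈ dom fA → x L.∈ dom fB →
  (∀ z → z ∈ fA [ x ] → z ∈ fB [ x ]) →
  (∀ y → y ∈ fA [ x ] → val fA y ≡ val fB y) →
  val fA x ≥ val fB x

InPow : ∀ {k} → List ℕ → Pt k → Set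
InPow E x = All (λ n → n L.∈ E) x

InImage : ∀ {k} → ℕ ⤖ ℤ → T k → List ℕ → (Pt k → ℕ → Set) → ℤ → Set
InImage {k} γ f E cond z =
  Σ (Pt k) λ x → InPow E x × cond x (val f x) × Bijection.to γ (val f x) ≡ z

Cond₀ Cond₁ Cond₂ : ∀ {k} → List ℕ → Pt k → ℕ → Set
Cond₀ E x v = v < lmin E
Cond₁ E x v = lmin E ≤ v × v < vmin x
Cond₂ E x v = v ≥ vmin x

InF : ∀ {k} → (γ₀ γ₁ γ₂ : ℕ ⤖ ℤ) → T k → List ℕ → ℤ → Set
InF γ₀ γ₁ γ₂ f E z =
  InImage γ₀ f E (Cond₀ E) z ⊎ InImage γ₁ f E (Cond₁ E) z ⊎ InImage γ₂ f E (Cond₂ E) z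

InH : ∀ {k} → (γ₀ γ₂ : ℕ ⤖ ℤ) → T k → List ℕ → ℤ → Set
InH γ₀ γ₂ f E z =
  InImage γ₀ f E (Cond₀ E) z ⊎ InImage γ₂ f E (Cond₂ E) z

{-# OPTIONS --safe #-}
module Submission where

-- Let p be the required size of E. Take ordinals below ω^p as coordinates, realized as natural
-- numbers by reading the Cantor normal form in a large base N. A finite set D of ordinal points
-- then has a function f_D from S, whose values are ordinals again. By recursion on max x, let the
-- true value of x be the least f_D(x) over all finite D on which f_D takes the true values below
-- max x. Jump freeness says that f_D(x) can only decrease when D grows while the values below
-- max x stay the same; hence a finite union of sets attaining true values, suitably cut down,
-- attains them all at once. Choose e_p = ω^(p-1) and then e_(p-1) > … > e_1, each e_i an (i-1)-fold
-- iterated limit below e_(i+1) and above every true value less than e_(i+1) of a tuple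
-- from {e_(i+1), …, e_p}. A true value of a tuple x from E is then either ≥ min x or < e_1, so A₁
-- is empty for a finite D attaining the true values on E^k.
--
-- True values need excluded middle, and comparisons hold only for large N. Both are handled by a
-- forcing interpretation: a world is a condition on N, it is "good" if it yields the conclusion
-- for all large N satisfying it, and "good" replaces falsity. Because a function from S has only
-- finitely many possible values at a point, a world is good as soon as each of its refinements
-- deciding that value is good.

open import Defs renaming (refl to reflexive)
open import Data.Nat
  using (ℕ; zero; suc; _+_; _*_; _^_; _≤_; _<_; _≥_; _⊓_; _⊔_; s≤s; z≤n)
import Data.Nat.Properties as ℕ
import Data.Nat.Induction as ℕ
open import Data.Integer using (ℤ)
open import Data.List using (List; []; _∷_; length; concatMap; filter; _++_)
import Data.List as List
import Data.List.Properties as List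
open import Data.List.Relation.Unary.All using (All; []; _∷_)
import Data.List.Relation.Unary.All as All
import Data.List.Relation.Unary.All.Properties as All
open import Data.List.Relation.Unary.Any using (Any; here; there)
open import Data.List.Relation.Unary.AllPairs using (AllPairs; []; _∷_)
import Data.List.Relation.Unary.AllPairs as AllPairs
import Data.List.Relation.Unary.AllPairs.Properties as AllPairs
open import Data.List.Relation.Unary.Unique.Propositional using (Unique)
import Data.List.Membership.Propositional as L
open import Data.List.Membership.Propositional.Properties
  using (∈-map⁺; ∈-map⁻; ∈-concatMap⁺; ∈-filter⁺; ∈-filter⁻; ∈-++⁺ˡ; ∈-++⁺ʳ; ∈-++⁻
        ; ∈-cartesianProductWith⁺; ∈-cartesianProductWith⁻)
open import Data.Vec using (Vec; []; _∷_; replicate; toList)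
import Data.Vec as Vec
import Data.Vec.Membership.Propositional as V
import Data.Vec.Membership.Propositional.Properties as V
import Data.Vec.Relation.Unary.All as VAll
open VAll using ([]; _∷_)
import Data.Vec.Relation.Unary.Any as VAny
import Data.Vec.Relation.Unary.Any.Properties as VAny
import Data.Vec.Relation.Binary.Lex.Strict as Lex
open Lex using (Lex-<; this; next)
open import Data.Vec.Relation.Binary.Pointwise.Inductive using (Pointwise-≡⇒≡; ≡⇒Pointwise-≡)
open import Data.Product using (Σ; ∃; _×_; _,_; proj₁; proj₂)
open import Data.Sum using (_⊎_; inj₁; inj₂; [_,_]′)
import Data.Sum as Sum
open import Data.Unit using (⊤; tt)
open import Function using (id; _∘_; const)
open import Function.Bundles using (_⇔_; _⤖_; mk⇔; Equivalence)
open import Induction.WellFounded using (Acc; acc; WellFounded)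
open import Level using (Level) renaming (_⊔_ to _⊔ℓ_; suc to lsuc)
open import Relation.Binary
  using (Trichotomous; tri<; tri≈; tri>; Transitive; Decidable; IsStrictTotalOrder)
open import Relation.Binary.PropositionalEquality
  using (_≡_; refl; sym; trans; cong; subst; subst₂)
open import Relation.Nullary using (¬_; yes; no; contradiction)
open import Relation.Unary using (_⊆_; _∩_)

private variable
  ℓ : Level
  X : Set
  k m n : ℕ

-- Ordinals below ω^n and iterated limits

Ord : ℕ → Set
Ord n = Vec ℕ n

infix 4 _≺_

_≺_ : Ord n → Ord n → Set
_≺_ = Lex-< _≡_ _<_

private module Lex≺ {n} = IsStrictTotalOrder (Lex.<-isStrictTotalOrder ℕ.<-isStrictTotalOrder {n})

≺-trans : Transitive (_≺_ {n})
≺-trans = Lex≺.trans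

≺-irrefl : {u : Ord n} → ¬ u ≺ u
≺-irrefl = Lex≺.irrefl (≡⇒Pointwise-≡ refl)

≺-cmp : Trichotomous _≡_ (_≺_ {n})
≺-cmp u v with Lex≺.compare u v
... | tri< a b c = tri< a (b ∘ ≡⇒Pointwise-≡) c
... | tri≈ a b c = tri≈ a (Pointwise-≡⇒≡ b) c
... | tri> a b c = tri> a (b ∘ ≡⇒Pointwise-≡) c

_≺?_ : Decidable (_≺_ {n})
_≺?_ = Lex≺._<?_

≺-wellFounded : WellFounded (_≺_ {n})
≺-wellFounded = Lex.<-wellFounded trans (λ { refl → id }) ℕ.<-wellFounded

≮0 : {u : Ord n} → ¬ u ≺ replicate n 0
≮0 {u = _ ∷ _} (next refl u≺0) = ≮0 u≺0

_⊔ₒ_ : Ord n → Ord n → Ord n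
u ⊔ₒ v with u ≺? v
... | yes _ = v
... | no  _ = u

-- e is an m-fold iterated limit; Lim 1 says that e is a limit ordinal.
Lim : ℕ → Ord n → Set
Lim zero    e = ⊤
Lim (suc m) e = (∃ λ u → u ≺ e) × (∀ {u} → u ≺ e → ∃ λ e′ → u ≺ e′ × e′ ≺ e × Lim m e′)

lim-∷ : ∀ m a {e : Ord n} → Lim m e → Lim m (a ∷ e)
lim-∷ zero    a lim                = tt
lim-∷ (suc m) a ((u₀ , u₀≺e) , lim) = (a ∷ u₀ , next refl u₀≺e) , λ where
  -- A smaller leading digit already decides the comparison, so any `e′` below `e` will do; `u₀`
  -- supplies one.
  (this b<a _) → let e′ , _ , e′≺e , l = lim u₀≺e
                 in a ∷ e′ , this b<a refl , next refl e′≺e , lim-∷ m a l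
  (next refl u≺e) → let e′ , u≺e′ , e′≺e , l = lim u≺e
                    in a ∷ e′ , next refl u≺e′ , next refl e′≺e , lim-∷ m a l

lim-power : ∀ n a → Lim n (suc a ∷ replicate n 0)
lim-power zero    a = tt
lim-power (suc n) a = (a ∷ replicate (suc n) 0 , this (ℕ.n<1+n a) refl) , below
  where
  below : ∀ {u} → u ≺ suc a ∷ replicate (suc n) 0 →
          ∃ λ e → u ≺ e × e ≺ suc a ∷ replicate (suc n) 0 × Lim n e
  below {b ∷ c ∷ u} (this (s≤s b≤a) _) =
    -- This exceeds `b ∷ c ∷ u` if `b < a`, and by its second digit if `b ≡ a`.
    a ∷ suc c ∷ replicate n 0
    , [ (λ b<a → this b<a refl) , (λ { refl → next refl (this (ℕ.n<1+n c) refl) }) ]′ (ℕ.m≤n⇒m<n∨m≡n b≤a)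
    , this (ℕ.n<1+n a) refl
    , lim-∷ n a (lim-power n c)
  below (next refl u≺0) = contradiction u≺0 ≮0

upper-bound : {e u₀ : Ord n} → u₀ ≺ e → (xs : List X) (g : ∀ {x} → x L.∈ xs → Ord n) →
              ∃ λ u → u ≺ e × (∀ {x} (p : x L.∈ xs) → g p ≺ e → ¬ u ≺ g p)
upper-bound u₀≺e [] g = _ , u₀≺e , λ ()
upper-bound {e = e} u₀≺e (x ∷ xs) g
  with upper-bound u₀≺e xs (g ∘ there) | g (here refl) ≺? e
... | u , u≺e , ub | no  g⊀e = u , u≺e , λ where
        (here refl) g≺e → contradiction g≺e g⊀e
        (there p)       → ub p
... | u , u≺e , ub | yes g≺e with u ≺? g (here refl)
...   | no  u⊀g = u , u≺e , λ where
          (here refl) _ → u⊀g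
          (there p)     → ub p
...   | yes u≺g = _ , g≺e , λ where
          (here refl) _   → ≺-irrefl
          (there p)   q r → ub p q (≺-trans u≺g r)

-- The finitely many `g p` below `e` have a bound `u ≺ e`, and the limit property gives an `e′` past
-- `u`.
limit-above : ∀ m {e : Ord n} → Lim (suc m) e → (xs : List X) (g : ∀ {x} → x L.∈ xs → Ord n) →
              ∃ λ e′ → e′ ≺ e × Lim m e′ × (∀ {x} (p : x L.∈ xs) → g p ≺ e → g p ≺ e′)
limit-above m {e} ((_ , u₀≺e) , lim) xs g
  with u , u≺e , ub ← upper-bound u₀≺e xs g
  with e′ , u≺e′ , e′≺e , l ← lim u≺e
  = e′ , e′≺e , l , below
  where
  below : ∀ {x} (p : x L.∈ xs) → g p ≺ e → g p ≺ e′
  below p g≺e with ≺-cmp (g p) e′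
  ... | tri< lt _ _ = lt
  ... | tri≈ _ eq _ = contradiction (subst (u ≺_) (sym eq) u≺e′) (ub p g≺e)
  ... | tri> _ _ gt = contradiction (≺-trans u≺e′ gt) (ub p g≺e)

-- Used with `Good w` for `G`: goodness acts as an escape from a finite conjunction.
⊎-all : {G : Set} {P : X → Set ℓ} (xs : List X) →
        (∀ {x} → x L.∈ xs → G ⊎ P x) → G ⊎ (∀ {x} → x L.∈ xs → P x)
⊎-all []       h = inj₂ λ ()
⊎-all (x ∷ xs) h with h (here refl) | ⊎-all xs (h ∘ there)
... | inj₁ g | _       = inj₁ g
... | inj₂ _ | inj₁ g  = inj₁ g
... | inj₂ p | inj₂ ps = inj₂ λ { (here refl) → p ; (there q) → ps q }

-- Worlds and forcing for all large N

World : Set₁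
World = ℕ → Set

private variable
  A B C : World
  v w : World

infix 3 _⊩_

_⊩_ : World → World → Set
w ⊩ A = ∃ λ n → ∀ {N} → n ≤ N → w N → A N

⊩-pure : w ⊆ A → w ⊩ A
⊩-pure f = 0 , λ _ → f

⊩-map : A ⊆ B → w ⊩ A → w ⊩ B
⊩-map f (n , a) = n , λ le wN → f (a le wN)

⊩-zip : (∀ {N} → A N → B N → C N) → w ⊩ A → w ⊩ B → w ⊩ C
⊩-zip f (m , a) (n , b) = m ⊔ n , λ le wN →
  f (a (ℕ.m⊔n≤o⇒m≤o m n le) wN) (b (ℕ.m⊔n≤o⇒n≤o m n le) wN)

⊩-⊆ : v ⊆ w → w ⊩ A → v ⊩ A
⊩-⊆ s (n , a) = n , λ le vN → a le (s vN)

⊩-All : {A : X → World} {xs : List X} → All (λ x → w ⊩ A x) xs → w ⊩ λ N → All (λ x → A x N) xs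
⊩-All []       = ⊩-pure λ _ → []
⊩-All (a ∷ as) = ⊩-zip _∷_ a (⊩-All as)

⊩-∈ : {A : X → World} {xs : List X} → (∀ {x} → x L.∈ xs → w ⊩ A x) →
      w ⊩ λ N → ∀ {x} → x L.∈ xs → A x N
⊩-∈ h = ⊩-map (λ as {x} x∈ → All.lookup as {x} x∈) (⊩-All (All.tabulate h))

⊩-VAny : {A : X → World} {x : Vec X k} → VAny.Any (λ u → w ⊩ A u) x → w ⊩ λ N → VAny.Any (λ u → A u N) x
⊩-VAny (VAny.here a)  = ⊩-map VAny.here a
⊩-VAny (VAny.there a) = ⊩-map VAny.there (⊩-VAny a)

⊩-AllPairs : {A : X → X → World} {xs : List X} →
             AllPairs (λ x y → w ⊩ A x y) xs → w ⊩ λ N → AllPairs (λ x y → A x y N) xs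
⊩-AllPairs []       = ⊩-pure λ _ → []
⊩-AllPairs (a ∷ as) = ⊩-zip _∷_ (⊩-All a) (⊩-AllPairs as)

-- Evaluation of the ordinal ω^(n-1)·u₁ + … + u_n at ω = N; it is monotone only once N exceeds all digits.
emb : ℕ → Ord n → ℕ
emb N []            = 0
emb {suc n} N (a ∷ u) = a * N ^ n + emb N u

emb-0 : ∀ n N → emb N (replicate n 0) ≡ 0
emb-0 zero    N = refl
emb-0 (suc n) N = emb-0 n N

emb-bound : (u : Ord n) → w ⊩ λ N → emb N u < N ^ n
emb-bound []            = ⊩-pure λ _ → s≤s z≤n
emb-bound {suc n} (a ∷ u) = ⊩-zip step (suc a , λ a<N _ → a<N) (emb-bound u)
  where
  open ℕ.≤-Reasoning
  step : ∀ {N} → a < N → emb N u < N ^ n → a * N ^ n + emb N u < N * N ^ n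
  step {N} a<N u<N = begin-strict
    a * N ^ n + emb N u <⟨ ℕ.+-monoʳ-< (a * N ^ n) u<N ⟩
    a * N ^ n + N ^ n   ≡⟨ ℕ.+-comm (a * N ^ n) (N ^ n) ⟩
    suc a * N ^ n       ≤⟨ ℕ.*-monoˡ-≤ (N ^ n) a<N ⟩
    N * N ^ n           ∎

emb-mono : {u v : Ord n} → u ≺ v → w ⊩ λ N → emb N u < emb N v
emb-mono {suc n} {u = a ∷ u} {v = b ∷ v} (this a<b _) = ⊩-map step (emb-bound u)
  where
  open ℕ.≤-Reasoning
  step : ∀ {N} → emb N u < N ^ n → a * N ^ n + emb N u < b * N ^ n + emb N v
  step {N} u<N = begin-strict
    a * N ^ n + emb N u <⟨ ℕ.+-monoʳ-< (a * N ^ n) u<N ⟩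
    a * N ^ n + N ^ n   ≡⟨ ℕ.+-comm (a * N ^ n) (N ^ n) ⟩
    suc a * N ^ n       ≤⟨ ℕ.*-monoˡ-≤ (N ^ n) a<b ⟩
    b * N ^ n           ≤⟨ ℕ.m≤m+n (b * N ^ n) (emb N v) ⟩
    b * N ^ n + emb N v ∎
emb-mono {suc n} {u = a ∷ u} (next refl u≺v) = ⊩-map (λ {N} → ℕ.+-monoʳ-< (a * N ^ n)) (emb-mono u≺v)

emb-mono-⊀ : {u v : Ord n} → ¬ v ≺ u → w ⊩ λ N → emb N u ≤ emb N v
emb-mono-⊀ {u = u} {v} v⊀u with ≺-cmp u v
... | tri< u≺v _ _  = ⊩-map ℕ.<⇒≤ (emb-mono u≺v)
... | tri≈ _ refl _ = ⊩-pure λ _ → ℕ.≤-refl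
... | tri> _ _ v≺u  = contradiction v≺u v⊀u

emb-⊔ : (u v : Ord n) → w ⊩ λ N → emb N (u ⊔ₒ v) ≡ emb N u ⊔ emb N v
emb-⊔ u v with u ≺? v
... | yes u≺v = ⊩-map (λ lt → sym (ℕ.m≤n⇒m⊔n≡n (ℕ.<⇒≤ lt))) (emb-mono u≺v)
... | no  u⊀v = ⊩-map (λ le → sym (ℕ.m≥n⇒m⊔n≡m le)) (emb-mono-⊀ u⊀v)

-- Points with ordinal coordinates

OPt : ℕ → ℕ → Set
OPt n k = Vec (Ord n) k

realize : ℕ → OPt n k → Pt k
realize N = Vec.map (emb N)

level : OPt n k → Ord n
level []      = replicate _ 0
level (u ∷ x) = u ⊔ₒ level x

vmax-realize : (x : OPt n k) → w ⊩ λ N → vmax (realize N x) ≡ emb N (level x)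
vmax-realize {n = n} [] = ⊩-pure λ {N} _ → sym (emb-0 n N)
vmax-realize (u ∷ x) =
  ⊩-zip (λ {N} e f → trans (cong (emb N u ⊔_) e) (sym f)) (vmax-realize x) (emb-⊔ u (level x))

vmax-reflects-≺ : (x y : OPt n k) → ¬ level x ≺ level y →
                  w ⊩ λ N → ¬ vmax (realize N x) < vmax (realize N y)
vmax-reflects-≺ x y x⊀y =
  ⊩-zip (λ { (e , f) le lt → ℕ.≤⇒≯ le (subst₂ _<_ e f lt) })
    (⊩-zip _,_ (vmax-realize x) (vmax-realize y)) (emb-mono-⊀ x⊀y)

-- Powers of finite sets, minima, and emptiness of A₁

pow : ∀ k → List X → List (Vec X k)
pow zero    E = [] ∷ []
pow (suc k) E = List.cartesianProductWith _∷_ E (pow k E)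

∈-pow⁺ : {E : List X} {x : Vec X k} → VAll.All (L._∈ E) x → x L.∈ pow k E
∈-pow⁺ []       = here refl
∈-pow⁺ (e ∷ es) = ∈-cartesianProductWith⁺ _∷_ e (∈-pow⁺ es)

∈-pow⁻ : ∀ k (E : List X) {x : Vec X k} → x L.∈ pow k E → VAll.All (L._∈ E) x
∈-pow⁻ zero E (here refl) = []
∈-pow⁻ (suc k) E p with ∈-cartesianProductWith⁻ _∷_ E (pow k E) p
... | _ , _ , e , es , refl = e ∷ ∈-pow⁻ k E es

All-∷-split : {e : X} {es : List X} {x : Vec X k} → VAll.All (L._∈ e ∷ es) x →
              VAll.All (L._∈ es) x ⊎ VAny.Any (_≡ e) x
All-∷-split []                = inj₁ []
All-∷-split (here refl ∷ _)   = inj₂ (VAny.here refl)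
All-∷-split (there u∈es ∷ ps) = Sum.map (u∈es ∷_) VAny.there (All-∷-split ps)

InPow-realize : (E : List (Ord n)) {N : ℕ} {x : Pt k} → InPow (List.map (emb N) E) x →
                ∃ λ y → VAll.All (L._∈ E) y × x ≡ realize N y
InPow-realize E []       = [] , [] , refl
InPow-realize E {N} (p ∷ ps) with ∈-map⁻ (emb N) p | InPow-realize E ps
... | u , u∈E , refl | y , y∈E , refl = u ∷ y , u∈E ∷ y∈E , refl

foldr-⊓≤ : ∀ a (x : Vec ℕ n) → Vec.foldr _ _⊓_ a x ≤ a
foldr-⊓≤ a []      = ℕ.≤-refl
foldr-⊓≤ a (b ∷ x) = ℕ.≤-trans (ℕ.m⊓n≤n b _) (foldr-⊓≤ a x)

foldr-⊓≤-any : ∀ a {x : Vec ℕ n} → VAny.Any (_≤ m) x → Vec.foldr _ _⊓_ a x ≤ m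
foldr-⊓≤-any a {b ∷ x} (VAny.here b≤m) = ℕ.≤-trans (ℕ.m⊓n≤m b _) b≤m
foldr-⊓≤-any a {b ∷ x} (VAny.there p)  = ℕ.≤-trans (ℕ.m⊓n≤n b _) (foldr-⊓≤-any a p)

vmin≤ : {x : Pt k} → VAny.Any (_≤ m) x → vmin x ≤ m
vmin≤ {x = a ∷ x} (VAny.here a≤m) = ℕ.≤-trans (foldr-⊓≤ a x) a≤m
vmin≤ {x = a ∷ x} (VAny.there p)  = foldr-⊓≤-any a p

<lmin : ∀ {a as} → m < a → All (m <_) as → m < lmin (a ∷ as)
<lmin m<a []         = m<a
<lmin m<a (m<b ∷ ms) = ℕ.⊓-glb m<b (<lmin m<a ms)

-- The hypothesis contradicts `Cond₁` at every point, so A₁ is empty.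
no-middle⇒F⇔H : ∀ (γ₀ γ₁ γ₂ : ℕ ⤖ ℤ) (f : T k) E →
  (∀ x → InPow E x → vmin x ≤ val f x ⊎ val f x < lmin E) →
  ∀ z → InF γ₀ γ₁ γ₂ f E z ⇔ InH γ₀ γ₂ f E z
no-middle⇒F⇔H {k} γ₀ γ₁ γ₂ f E settled z = mk⇔ to (Sum.map₂ inj₂)
  where
  to : InF γ₀ γ₁ γ₂ f E z → InH γ₀ γ₂ f E z
  to (inj₁ a₀)        = inj₁ a₀
  to (inj₂ (inj₂ a₂)) = inj₂ a₂
  to (inj₂ (inj₁ (x , x∈E , (minE≤v , v<minx) , _))) with settled x x∈E
  ... | inj₁ minx≤v = contradiction v<minx (ℕ.≤⇒≯ minx≤v)
  ... | inj₂ v<minE = contradiction v<minE (ℕ.≤⇒≯ minE≤v)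

-- Functions of the family on ordinal points

module Forcing {k n : ℕ} (S : Family k) (full : Full S) (jumpFree : JumpFree S) (Goal : Set) where

  Point : Set
  Point = OPt n k

  fam : ℕ → List Point → T k
  fam N D = proj₁ (full (List.map (realize N) D))

  fam∈S : ∀ N D → S (fam N D)
  fam∈S N D = proj₁ (proj₂ (full (List.map (realize N) D)))

  ∈-dom⁺ : ∀ {N D x} → x L.∈ D → realize N x L.∈ dom (fam N D)
  ∈-dom⁺ {N} {D} x∈D =
    Equivalence.from (proj₂ (proj₂ (full (List.map (realize N) D))) _) (∈-map⁺ (realize N) x∈D)

  ∈-dom⁻ : ∀ {N D z} → z L.∈ dom (fam N D) → ∃ λ x → x L.∈ D × z ≡ realize N x
  ∈-dom⁻ {N} {D} z∈dom =
    ∈-map⁻ (realize N) (Equivalence.to (proj₂ (proj₂ (full (List.map (realize N) D))) _) z∈dom)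

  value : ℕ → List Point → Point → ℕ
  value N D x = val (fam N D) (realize N x)

  -- Reflexivity makes the value a coordinate of a realized point of `D`.
  value∈field : ∀ N {D x} → x L.∈ D → Any (λ v → value N D x ≡ emb N v) (concatMap toList D)
  value∈field N {D} {x} x∈D
    with z , z∈dom , v∈z ← reflexive (fam N D) (realize N x) (∈-dom⁺ x∈D)
    with y , y∈D , refl ← ∈-dom⁻ {N} {D} z∈dom
    with v , v∈y , eq ← V.fromAny (VAny.map⁻ v∈z)
    = L.lose (∈-concatMap⁺ toList (L.lose y∈D (V.∈-toList⁺ v∈y))) eq

  Ans : World → List Point → Point → Ord n → Set
  Ans w D x v = w ⊩ λ N → value N D x ≡ emb N v

  Good : World → Set
  Good w = w ⊩ const Goal

  -- "P is eventually attained", in continuation-passing form with Good as falsity.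
  ◇ : (World → Set ℓ) → World → Set (lsuc Level.zero ⊔ℓ ℓ)
  ◇ P w = (∀ {w′} → w′ ⊆ w → P w′ → Good w′) → Good w

  -- Points are treated in turn, each in a refinement of the previous world; `mono` carries earlier
  -- facts along.
  ◇-all : {P : X → World → Set ℓ} → (∀ {x v w} → v ⊆ w → P x w → P x v) →
          (xs : List X) → (∀ {x v} → x L.∈ xs → v ⊆ w → ◇ (P x) v) →
          ◇ (λ v → ∀ {x} → x L.∈ xs → P x v) w
  ◇-all mono []       h κ = κ id λ ()
  ◇-all mono (x ∷ xs) h κ =
    h (here refl) id λ s p →
    ◇-all mono xs (λ x∈ s′ → h (there x∈) (s ∘ s′)) λ s′ ps →
    κ (s ∘ s′) λ { (here refl) → mono s′ p ; (there x∈) → ps x∈ }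

  -- The field of D is finite and does not depend on N, so the possible values split the world.
  query : ∀ {D x} → x L.∈ D → ◇ (λ v → ∃ (Ans v D x)) w
  query {w} {D} {x} x∈D κ = ⊩-zip (λ branches any → All.lookupWith (λ f eq → f eq) branches any)
    (⊩-All (All.universal branch (concatMap toList D)))
    (⊩-pure λ {N} _ → value∈field N x∈D)
    where
    branch : ∀ v → w ⊩ λ N → value N D x ≡ emb N v → Goal
    branch v with m , good ← κ {w ∩ λ N → value N D x ≡ emb N v} proj₁ (v , ⊩-pure proj₂)
      = m , λ le wN eq → good le (wN , eq)

  -- For large `N`, a point of the finite list `A` with smaller `vmax` also has smaller `level`, so
  -- hypotheses on levels suffice.
  jump-free : ∀ {A B x} → x L.∈ A → x L.∈ B →
    (∀ {y} → y L.∈ A → level y ≺ level x → y L.∈ B) →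
    (∀ {y} → y L.∈ A → level y ≺ level x → w ⊩ λ N → value N A y ≡ value N B y) →
    w ⊩ λ N → value N A x ≥ value N B x
  jump-free {w} {A} {B} {x} x∈A x∈B sub agree = ⊩-map step (⊩-∈ lower)
    where
    Lower : Point → World
    Lower y N = vmax (realize N y) < vmax (realize N x) → y L.∈ B × value N A y ≡ value N B y

    lower : ∀ {y} → y L.∈ A → w ⊩ Lower y
    lower {y} y∈A with level y ≺? level x
    ... | yes y≺x = ⊩-map (λ eq _ → sub y∈A y≺x , eq) (agree y∈A y≺x)
    ... | no  y⊀x = ⊩-map (λ ≮ lt → contradiction lt ≮) (vmax-reflects-≺ y x y⊀x)

    step : ∀ {N} → (∀ {y} → y L.∈ A → Lower y N) → value N A x ≥ value N B x
    step {N} low = jumpFree (fam N A) (fam N B) (fam∈S N A) (fam∈S N B) (realize N x)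
      (∈-dom⁺ x∈A) (∈-dom⁺ x∈B)
      (λ { z (z∈ , lt) → let y , y∈A , e = ∈-dom⁻ {N} {A} z∈ in inB e (low y∈A) lt , lt })
      (λ { z (z∈ , lt) → let y , y∈A , e = ∈-dom⁻ {N} {A} z∈ in eq e (low y∈A) lt })
      where
      inB : ∀ {y z} → z ≡ realize N y → Lower y N → vmax z < vmax (realize N x) → z L.∈ dom (fam N B)
      inB refl l lt = ∈-dom⁺ (proj₁ (l lt))
      eq : ∀ {y z} → z ≡ realize N y → Lower y N → vmax z < vmax (realize N x) →
           val (fam N A) z ≡ val (fam N B) z
      eq refl l lt = proj₂ (l lt)

  -- True values

  -- `P` stands for the true values of lower level, whose definition recurses through this one.
  CorrectBelow : (u : Ord n) → (∀ y → level y ≺ u → World → Ord n → Set₁) →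
                 World → List Point → Set₁
  CorrectBelow u P w D = ∀ {y} → y L.∈ D → (y≺u : level y ≺ u) → ∃ λ v → Ans w D y v × P y y≺u w v

  -- A smaller value that is attained in a stronger world makes that world good: this is the forced
  -- form of leastness. Its hypothesis mentions true values of lower level, so the definition is a
  -- recursion on the level and not an inductive one.
  TrueValueAcc : {u : Ord n} → Acc _≺_ u → Point → World → Ord n → Set₁
  TrueValueAcc {u} (acc rs) x w v =
    (∃ λ D → x L.∈ D × CorrectBelow u P w D × Ans w D x v) ×
    (∀ {w′ D v′} → w′ ⊆ w → x L.∈ D → CorrectBelow u P w′ D → Ans w′ D x v′ → v′ ≺ v → Good w′)
    where
    P : ∀ y → level y ≺ u → World → Ord n → Set₁
    P y y≺u = TrueValueAcc (rs y≺u) y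

  -- Correctness occurs negatively in the leastness clause, so there the two accessibility proofs
  -- swap roles.
  TrueValueAcc-irrelevant : ∀ {u x v} (a b : Acc _≺_ u) → TrueValueAcc a x w v → TrueValueAcc b x w v
  TrueValueAcc-irrelevant (acc rs) (acc rs′) ((D , x∈D , cb , ans) , least) =
    (D , x∈D , (λ y∈ p → let v , a , t = cb y∈ p in v , a , TrueValueAcc-irrelevant (rs p) (rs′ p) t) , ans) ,
    λ s x∈ cb′ → least s x∈ λ y∈ p → let v , a , t = cb′ y∈ p in v , a , TrueValueAcc-irrelevant (rs′ p) (rs p) t

  TrueValue : Point → World → Ord n → Set₁
  TrueValue x = TrueValueAcc (≺-wellFounded (level x)) x

  Correct : Ord n → World → List Point → Set₁
  Correct u = CorrectBelow u λ y _ → TrueValue y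

  Attained : Point → World → Ord n → Set₁
  Attained x w v = ∃ λ D → x L.∈ D × Correct (level x) w D × Ans w D x v

  Least : Point → World → Ord n → Set₁
  Least x w v = ∀ {w′ D v′} → w′ ⊆ w → x L.∈ D → Correct (level x) w′ D → Ans w′ D x v′ → v′ ≺ v → Good w′

  private
    toAcc : ∀ {x v} (a : Acc _≺_ (level x)) → Attained x w v × Least x w v → TrueValueAcc a x w v
    toAcc (acc rs) ((D , x∈D , cb , ans) , least) =
      (D , x∈D , (λ y∈ p → let v , a , t = cb y∈ p in v , a , TrueValueAcc-irrelevant _ (rs p) t) , ans) ,
      λ s x∈ cb′ → least s x∈ λ y∈ p → let v , a , t = cb′ y∈ p in v , a , TrueValueAcc-irrelevant (rs p) _ t

    fromAcc : ∀ {x v} (a : Acc _≺_ (level x)) → TrueValueAcc a x w v → Attained x w v × Least x w v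
    fromAcc (acc rs) ((D , x∈D , cb , ans) , least) =
      (D , x∈D , (λ y∈ p → let v , a , t = cb y∈ p in v , a , TrueValueAcc-irrelevant (rs p) _ t) , ans) ,
      λ s x∈ cb′ → least s x∈ λ y∈ p → let v , a , t = cb′ y∈ p in v , a , TrueValueAcc-irrelevant _ (rs p) t

  trueValue : ∀ {x v} → Attained x w v → Least x w v → TrueValue x w v
  trueValue a l = toAcc (≺-wellFounded _) (a , l)

  attained : ∀ {x v} → TrueValue x w v → Attained x w v
  attained t = proj₁ (fromAcc (≺-wellFounded _) t)

  least : ∀ {x v} → TrueValue x w v → Least x w v
  least t = proj₂ (fromAcc (≺-wellFounded _) t)

  -- Leastness persists because it already quantifies over all refinements.
  TrueValueAcc-⊆ : ∀ {w w′ u x v} (a : Acc _≺_ u) → w′ ⊆ w → TrueValueAcc a x w v → TrueValueAcc a x w′ v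
  TrueValueAcc-⊆ (acc rs) s ((D , x∈D , cb , ans) , least) =
    (D , x∈D , (λ y∈ p → let v , a , t = cb y∈ p in v , ⊩-⊆ s a , TrueValueAcc-⊆ (rs p) s t) , ⊩-⊆ s ans) ,
    λ s′ → least (s ∘ s′)

  TrueValue-⊆ : ∀ {w w′ x v} → w′ ⊆ w → TrueValue x w v → TrueValue x w′ v
  TrueValue-⊆ = TrueValueAcc-⊆ (≺-wellFounded _)

  Correct-⊆ : ∀ {w w′ u D} → w′ ⊆ w → Correct u w D → Correct u w′ D
  Correct-⊆ s cb y∈ p = let v , a , t = cb y∈ p in v , ⊩-⊆ s a , TrueValue-⊆ s t

  -- The smaller of two true values is attained, which the leastness of the other turns into
  -- goodness.
  TrueValue-unique : ∀ {x u v} → TrueValue x w u → TrueValue x w v → Good w ⊎ u ≡ v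
  TrueValue-unique {u = u} {v} tu tv with ≺-cmp u v
  ... | tri< u≺v _ _ = let _ , x∈ , cb , a = attained tu in inj₁ (least tv id x∈ cb a u≺v)
  ... | tri≈ _ u≡v _ = inj₂ u≡v
  ... | tri> _ _ v≺u = let _ , x∈ , cb , a = attained tv in inj₁ (least tu id x∈ cb a v≺u)

  -- A least-element principle without excluded middle: `κ` is offered an attained value as least,
  -- and any smaller value produced against it restarts the descent in the stronger world.
  trueValue-exists : ∀ x → ◇ (λ w′ → ∃ (TrueValue x w′)) w
  -- The singleton domain has no point below `level x`, so it is vacuously correct.
  trueValue-exists {w} x κ = query {D = x ∷ []} (here refl) λ s (v , ans) →
    descend (≺-wellFounded v) s (here refl) (λ { (here refl) p → contradiction p ≺-irrefl ; (there ()) }) ans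
    where
    descend : ∀ {v w′ D} → Acc _≺_ v → w′ ⊆ w → x L.∈ D → Correct (level x) w′ D → Ans w′ D x v → Good w′
    descend (acc rs) s x∈D cb ans = κ s (_ , trueValue (_ , x∈D , cb , ans)
      λ s′ x∈D′ cb′ ans′ v′≺v → descend (rs v′≺v) (s ∘ s′) x∈D′ cb′ ans′)

  -- Finite domains attaining all their true values at once

  -- Only the part of `W` below `level y` has to lie in `D`, as jump freeness compares nothing else.
  Witness : World → List Point → Point → Set₁
  Witness w D y = ∃ λ W → ∃ λ v → y L.∈ W × (∀ {z} → z L.∈ W → level z ≺ level y → z L.∈ D) ×
                  Correct (level y) w W × Ans w W y v × TrueValue y w v

  -- By jump freeness f_D(y) is at most the true value v attained on the witness, and a smaller value
  -- contradicts the leastness of v.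
  correct-step : ∀ {D y a} → Witness w D y → y L.∈ D → Ans w D y a → Correct (level y) w D →
                 Good w ⊎ TrueValue y w a
  correct-step {w} {D} {y} {a} (W , v , y∈W , W⊆D , cbW , ansW , tv) y∈D ansD cbD =
    [ inj₁ , compare ]′ (⊎-all W agree)
    where
    agree : ∀ {z} → z L.∈ W → Good w ⊎ (level z ≺ level y → w ⊩ λ N → value N W z ≡ value N D z)
    agree {z} z∈W with level z ≺? level y
    ... | no  z⊀y = inj₂ λ z≺y → contradiction z≺y z⊀y
    ... | yes z≺y with cbW z∈W z≺y | cbD (W⊆D z∈W z≺y) z≺y
    ...   | u , eq , t | u′ , eq′ , t′ with TrueValue-unique t t′
    ...     | inj₁ good = inj₁ good
    ...     | inj₂ refl = inj₂ λ _ → ⊩-zip (λ e e′ → trans e (sym e′)) eq eq′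

    compare : (∀ {z} → z L.∈ W → level z ≺ level y → w ⊩ λ N → value N W z ≡ value N D z) →
              Good w ⊎ TrueValue y w a
    compare agree with ≺-cmp a v
    ... | tri< a≺v _ _  = inj₁ (least tv id y∈D cbD ansD a≺v)
    ... | tri≈ _ refl _ = inj₂ tv
    ... | tri> _ _ v≺a  = inj₁ (⊩-zip (λ { (ge , e , e′) lt → contradiction (subst₂ _≥_ e e′ ge) (ℕ.<⇒≱ lt) })
      (⊩-zip _,_ (jump-free y∈W y∈D W⊆D agree) (⊩-zip _,_ ansW ansD)) (emb-mono v≺a))

  -- All values on `D` are queried first, so that the induction on levels runs in one fixed world.
  witnessed⇒correct : ∀ {D} → (∀ {y} → y L.∈ D → Witness w D y) →
    ◇ (λ w′ → ∀ {y} → y L.∈ D → ∃ λ v → Ans w′ D y v × TrueValue y w′ v) w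
  witnessed⇒correct {w} {D} wit κ =
    ◇-all (λ s (v , a) → v , ⊩-⊆ s a) D (λ x∈D _ → query x∈D) λ s ans →
    [ id , κ s ]′ (⊎-all D λ y∈D → correct s ans (≺-wellFounded _) y∈D)
    where
    module _ {w′} (s : w′ ⊆ w) (ans : ∀ {y} → y L.∈ D → ∃ (Ans w′ D y)) where
      correct : ∀ {y} → Acc _≺_ (level y) → y L.∈ D → Good w′ ⊎ (∃ λ v → Ans w′ D y v × TrueValue y w′ v)
      correct {y} (acc rs) y∈D with ⊎-all D below
        where
        below : ∀ {z} → z L.∈ D →
          Good w′ ⊎ (level z ≺ level y → ∃ λ v → Ans w′ D z v × TrueValue z w′ v)
        below {z} z∈D with level z ≺? level y
        ... | no  z⊀y = inj₂ λ z≺y → contradiction z≺y z⊀y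
        ... | yes z≺y = Sum.map₂ const (correct (rs z≺y) z∈D)
      ... | inj₁ good = inj₁ good
      ... | inj₂ cb with wit y∈D
      ...   | W , v , y∈W , W⊆D , cbW , ansW , tv =
        Sum.map₂ (λ t → proj₁ (ans y∈D) , proj₂ (ans y∈D) , t)
          (correct-step (W , v , y∈W , W⊆D , Correct-⊆ s cbW , ⊩-⊆ s ansW , TrueValue-⊆ s tv)
                        y∈D (proj₂ (ans y∈D)) cb)

  Witness-⊆ : ∀ {D D′ y} → (∀ {z} → z L.∈ D → z L.∈ D′) → Witness w D y → Witness w D′ y
  Witness-⊆ D⊆D′ (W , v , y∈W , W⊆D , wit) = W , v , y∈W , (λ z∈ z≺y → D⊆D′ (W⊆D z∈ z≺y)) , wit

  -- Each `x` brings only the points of its attaining set `W` below `level x`. There `W` is correct,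
  -- so it witnesses those points as well.
  witnessed-superset : ∀ xs → (∀ {x} → x L.∈ xs → ∃ (TrueValue x w)) →
    ∃ λ D → (∀ {x} → x L.∈ xs → x L.∈ D) × (∀ {y} → y L.∈ D → Witness w D y)
  witnessed-superset []       tvs = [] , (λ ()) , λ ()
  witnessed-superset {w} (x ∷ xs) tvs
    with D , xs⊆D , wit ← witnessed-superset xs (tvs ∘ there)
    with v , tv ← tvs (here refl)
    with W , x∈W , cb , ans ← attained tv
    = x ∷ below ++ D , xs⊆ , wit′
    where
    below : List Point
    below = filter (λ z → level z ≺? level x) W

    below⁺ : ∀ {z} → z L.∈ W → level z ≺ level x → z L.∈ x ∷ below ++ D
    below⁺ z∈W z≺x = there (∈-++⁺ˡ (∈-filter⁺ (λ z → level z ≺? level x) z∈W z≺x))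

    xs⊆ : ∀ {y} → y L.∈ x ∷ xs → y L.∈ x ∷ below ++ D
    xs⊆ (here y≡x)   = here y≡x
    xs⊆ (there y∈xs) = there (∈-++⁺ʳ below (xs⊆D y∈xs))

    wit′ : ∀ {y} → y L.∈ x ∷ below ++ D → Witness w (x ∷ below ++ D) y
    wit′ (here refl) = W , v , x∈W , below⁺ , cb , ans , tv
    wit′ (there y∈) with ∈-++⁻ below y∈
    ... | inj₂ y∈D = Witness-⊆ (there ∘ ∈-++⁺ʳ below) (wit y∈D)
    ... | inj₁ y∈b with y∈W , y≺x ← ∈-filter⁻ (λ z → level z ≺? level x) y∈b
                   with u , a , t ← cb y∈W y≺x
                   = W , u , y∈W , (λ z∈W z≺y → below⁺ z∈W (≺-trans z≺y y≺x))
                   , (λ z∈W z≺y → cb z∈W (≺-trans z≺y y≺x)) , a , t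

  -- Construction of E from the top down

  Settled : Point → Ord n → Ord n → Set
  Settled x e v = VAny.Any (λ u → ¬ v ≺ u) x ⊎ v ≺ e

  AllSettled : World → List (Ord n) → Ord n → Set₁
  AllSettled w E e = ∀ {x} → x L.∈ pow k E → ∃ λ v → TrueValue x w v × Settled x e v

  -- A tuple containing `e` is settled either way: its value is below `e`, or the coordinate `e`
  -- does not exceed it.
  settle-∷ : ∀ {e es} → AllSettled w es e → ◇ (λ w′ → AllSettled w′ (e ∷ es) e) w
  settle-∷ {w} {e} {es} old κ =
    ◇-all (λ s (v , t) → v , TrueValue-⊆ s t) (pow k (e ∷ es)) (λ {x} _ _ → trueValue-exists x)
      λ s tvs → κ s (settled s tvs)
    where
    settled : ∀ {w′} → w′ ⊆ w → (∀ {x} → x L.∈ pow k (e ∷ es) → ∃ (TrueValue x w′)) →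
              AllSettled w′ (e ∷ es) e
    settled s tvs x∈ with All-∷-split (∈-pow⁻ k (e ∷ es) x∈)
    ... | inj₁ x∈es = let v , t , c = old (∈-pow⁺ x∈es) in v , TrueValue-⊆ s t , c
    ... | inj₂ e∈x with tvs x∈
    ...   | v , t with v ≺? e
    ...     | yes v≺e = v , t , inj₂ v≺e
    ...     | no  v⊀e = v , t , inj₁ (VAny.map (λ { refl → v⊀e }) e∈x)

  -- `e` is the next element to be added, and `m` more follow it, each using up one limit. Choosing
  -- `e′` above all values below `e` sharpens `v ≺ e` to `v ≺ e′`.
  settled-set : ∀ m {p e es} → Lim m e → length es + suc m ≡ p → AllPairs _≺_ (e ∷ es) →
    AllSettled w es e →
    (∀ {w′ e es} → length (e ∷ es) ≡ p → AllPairs _≺_ (e ∷ es) → AllSettled w′ (e ∷ es) e → Good w′) →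
    Good w
  settled-set zero {es = es} _ len sorted old κ =
    settle-∷ old λ _ → κ (trans (ℕ.+-comm 1 (length es)) len) sorted
  settled-set (suc m) {e = e} {es} lim len sorted@(e≺es ∷ _) old κ = settle-∷ old λ _ new →
    let e′ , e′≺e , lim′ , above = limit-above m lim (pow k (e ∷ es)) (λ x∈ → proj₁ (new x∈)) in
    settled-set m lim′ (trans (sym (ℕ.+-suc (length es) (suc m))) len)
      ((e′≺e ∷ All.map (≺-trans e′≺e) e≺es) ∷ sorted)
      (λ x∈ → let v , t , c = new x∈ in v , t , Sum.map₂ (above x∈) c) κ

  -- Uniqueness identifies the values taken on a common `D` with the settled true values.
  realize-settled : ∀ {e E} → AllSettled w E e →
    (∀ {w′ D} → (∀ {x} → x L.∈ pow k E → x L.∈ D) →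
      (∀ {x} → x L.∈ pow k E → ∃ λ v → Ans w′ D x v × Settled x e v) → Good w′) →
    Good w
  realize-settled {w} {e} {E} settled κ
    with D , pow⊆D , wit ← witnessed-superset (pow k E) (λ x∈ → let v , t , _ = settled x∈ in v , t)
    = witnessed⇒correct wit λ {w′} s correct →
      [ id , κ pow⊆D ]′ (⊎-all (pow k E) λ x∈ → match s (settled x∈) (correct (pow⊆D x∈)))
    where
    match : ∀ {w′ D x} → w′ ⊆ w → (∃ λ v → TrueValue x w v × Settled x e v) →
            (∃ λ v → Ans w′ D x v × TrueValue x w′ v) → Good w′ ⊎ (∃ λ v → Ans w′ D x v × Settled x e v)
    match s (v , t , c) (v′ , a , t′) with TrueValue-unique (TrueValue-⊆ s t) t′
    ... | inj₁ good = inj₁ good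
    ... | inj₂ refl = inj₂ (v , a , c)

-- Return from ordinals to natural numbers

theorem3p3 : (k : ℕ) → 2 ≤ k → (S : Family k) → Full S → JumpFree S →
    (γ₀ γ₁ γ₂ : ℕ ⤖ ℤ) → (p : ℕ) → 2 ≤ p →
    Σ (T k) λ f → S f × Σ (List ℕ) λ E → Unique E × length E ≡ p ×
    (∀ (x : Pt k) → InPow E x → x L.∈ dom f) ×
    (∀ (z : ℤ) → InF γ₀ γ₁ γ₂ f E z ⇔ InH γ₀ γ₂ f E z)
-- In the trivial world, `N` can be the threshold itself.
theorem3p3 k@(suc _) 2≤k S full jumpFree γ₀ γ₁ γ₂ p@(suc m) 2≤p = proj₂ good ℕ.≤-refl tt
  where
  Goal : Set
  Goal = Σ (T k) λ f → S f × Σ (List ℕ) λ E → Unique E × length E ≡ p ×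
    (∀ (x : Pt k) → InPow E x → x L.∈ dom f) ×
    (∀ (z : ℤ) → InF γ₀ γ₁ γ₂ f E z ⇔ InH γ₀ γ₂ f E z)

  open Forcing {k} {p} S full jumpFree Goal

  module _ {e : Ord p} {es : List (Ord p)} {D : List Point}
           (len : length (e ∷ es) ≡ p) (pow⊆D : ∀ {x} → x L.∈ pow k (e ∷ es) → x L.∈ D) where

    SettledAt : Point → World
    SettledAt x N = VAny.Any (λ u → emb N u ≤ value N D x) x ⊎ value N D x < emb N e

    settledAt : ∀ {w x} → (∃ λ v → Ans w D x v × Settled x e v) → w ⊩ SettledAt x
    settledAt (v , ans , inj₁ v⊀x) =
      ⊩-zip (λ {N} eq → inj₁ ∘ VAny.map (λ {u} → subst (emb N u ≤_) (sym eq))) ans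
        (⊩-VAny (VAny.map emb-mono-⊀ v⊀x))
    settledAt (v , ans , inj₂ v≺e) =
      ⊩-zip (λ {N} eq lt → inj₂ (subst (_< emb N e) (sym eq) lt)) ans (emb-mono v≺e)

    conclude : ∀ {N} → AllPairs (λ u v → emb N u < emb N v) (e ∷ es) →
               (∀ {x} → x L.∈ pow k (e ∷ es) → SettledAt x N) → Goal
    conclude {N} sorted@(e<es ∷ _) settled =
      fam N D , fam∈S N D , E
      , AllPairs.map⁺ (AllPairs.map ℕ.<⇒≢ sorted)
      , trans (List.length-map (emb N) (e ∷ es)) len
      , (λ x x∈E → let y , y∈ , eq = InPow-realize (e ∷ es) x∈E in
                   subst (L._∈ dom (fam N D)) (sym eq) (∈-dom⁺ (pow⊆D (∈-pow⁺ y∈))))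
      , no-middle⇒F⇔H γ₀ γ₁ γ₂ (fam N D) E λ x x∈E →
          let y , y∈ , eq = InPow-realize (e ∷ es) x∈E in
          subst (λ x → vmin x ≤ val (fam N D) x ⊎ val (fam N D) x < lmin E) (sym eq)
            (Sum.map (vmin≤ ∘ VAny.map⁺)
                     (λ v<e → <lmin v<e (All.map⁺ (All.map (ℕ.<-trans v<e) e<es)))
                     (settled (∈-pow⁺ y∈)))
      where
      E : List ℕ
      E = List.map (emb N) (e ∷ es)

  good : Good (const ⊤)
  -- The start is ω^m with `m = p - 1`; over the empty set there are no tuples to settle.
  good = settled-set m (lim-power m 0) refl ([] ∷ []) (λ x∈ → no-point (∈-pow⁻ k [] x∈))
    λ len sorted settled → realize-settled settled λ pow⊆D ans →
      ⊩-zip (conclude len pow⊆D) (⊩-AllPairs (AllPairs.map emb-mono sorted))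
        (⊩-∈ λ x∈ → settledAt len pow⊆D (ans x∈))
    where
    no-point : ∀ {j} {Y : Set ℓ} {x : Vec (Ord p) (suc j)} → VAll.All (L._∈ []) x → Y
    no-point (() ∷ _)
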